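{- There is a constant $c$ such that for every $n\in\mathbb N$ and every $n$-ary Boolean function $f:\mathbb B^n\to\mathbb B$ there exists an instruction sequence $X\in\mathrm{IS}^{na}_{br}$ such that the only jump instruction occurring in $X$ is $\#2$, $X$ computes $f$, and $|X|\le c\cdot (n+1)\cdot 2^n$ (i.e. $|X|=O(n\cdot 2^n)$).
   Context: $\mathbb B=\{T,F\}$. A primitive instruction is one of: a plain basic instruction $a$, a positive test instruction $+a$, a negative test instruction $-a$ (for a basic instruction $a$), a forward jump instruction $\#l$ ($l\in\mathbb N$), or the termination instruction $!$. An instruction sequence is a finite nonempty sequence $X=u_1;\dots;u_k$ of primitive instructions; its length is $|X|=k$. Basic instructions have the form $f.m$ where the focus $f$ is one of $\mathrm{in}{:}i$, $\mathrm{aux}{:}i$ ($i\ge 1$) or $\mathrm{out}$, each naming a Boolean register, and the method $m$ is one of $\mathrm{set}{:}T$, $\mathrm{set}{:}F$, $\mathrm{get}$. Executing $f.\mathrm{set}{:}b$ sets register $f$ to $b$ and yields reply $b$; executing $f.\mathrm{get}$ leaves the register unchanged and yields its content as reply. Execution of $X=u_1;\dots;u_k$: a counter starts at $1$. If the counter exceeds $k$, execution deadlocks. At position $i$: if $u_i=!$, execution terminates; if $u_i=\#l$, execution deadlocks if $l=0$ and otherwise the counter becomes $i+l$; if $u_i$ is $a$, $+a$ or $-a$, the basic instruction $a$ is executed yielding reply $r$, and the counter becomes $i+1$ for $u_i=a$; for $u_i=+a$ it becomes $i+1$ if $r=T$ and $i+2$ if $r=F$; for $u_i=-a$ it becomes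 $i+1$ if $r=F$ and $i+2$ if $r=T$. $\mathrm{IS}_{br}$ is the set of instruction sequences in which every basic instruction occurring (in a plain, positive test or negative test instruction) belongs to $\{f.\mathrm{get}: f=\mathrm{in}{:}i \text{ or } f=\mathrm{aux}{:}i\}\cup\{f.\mathrm{set}{:}b: f=\mathrm{aux}{:}i \text{ or } f=\mathrm{out},\ b\in\mathbb B\}$. $\mathrm{IS}^{na}_{br}\subseteq \mathrm{IS}_{br}$ is the set of those in which every basic instruction belongs to $\{\mathrm{in}{:}i.\mathrm{get}: i\ge1\}\cup\{\mathrm{out}.\mathrm{set}{:}T,\mathrm{out}.\mathrm{set}{:}F\}$. $X\in\mathrm{IS}_{br}$ computes $f:\mathbb B^n\to\mathbb B$ if for every $(b_1,\dots,b_n)\in\mathbb B^n$: when $X$ is executed with register $\mathrm{in}{:}j$ initialised to $b_j$ ($j\le n$) and all registers $\mathrm{aux}{:}i$ and $\mathrm{out}$ initialised to $F$, execution terminates (does not deadlock) without ever executing a basic instruction with focus $\mathrm{in}{:}j$ for $j>n$, and at termination register $\mathrm{out}$ contains $f(b_1,\dots,b_n)$. -}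

module Defs where

open import Data.Bool.Base using (Bool; true; false; if_then_else_)
open import Data.Fin.Base using (Fin; toℕ)
open import Data.List.Base using (List; []; _∷_)
open import Data.List.Membership.Propositional using (_∈_)
open import Data.List.NonEmpty.Base using (List⁺; toList; length)
open import Data.List.Relation.Unary.All using (All)
open import Data.Maybe.Base using (Maybe; just; nothing)
import Data.Nat.Properties as ℕ
open import Data.Nat.Base using (ℕ; zero; suc; _+_; _<_; NonZero)
open import Data.Product.Base using (_×_; _,_; ∃₂)
open import Data.Vec.Base using (Vec; lookup)
open import Relation.Binary.Definitions using (DecidableEquality)
open import Relation.Binary.PropositionalEquality.Core using (_≡_; refl)
open import Relation.Nullary.Decidable.Core using (yes; no; does)
open import Relation.Nullary.Negation.Core using (¬_)

-- The truth values T and F are `true` and `false`.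

data Focus : Set where
  in: aux: : (i : ℕ) .{{_ : NonZero i}} → Focus
  out      : Focus

data Method : Set where
  set: : Bool → Method
  get  : Method

infix 6 _·_

data Basic : Set where
  _·_ : Focus → Method → Basic

data Instr : Set where
  plain +test -test : Basic → Instr
  #_                : ℕ → Instr
  !                 : Instr

InstrSeq : Set
InstrSeq = List⁺ Instr

_≟_ : DecidableEquality Focus
in: i ≟ in: j with i ℕ.≟ j
... | yes refl = yes refl
... | no i≢j   = no λ { refl → i≢j refl }
in: _ ≟ aux: _ = no λ ()
in: _ ≟ out    = no λ ()
aux: _ ≟ in: _ = no λ ()
aux: i ≟ aux: j with i ℕ.≟ j
... | yes refl = yes refl
... | no i≢j   = no λ { refl → i≢j refl }
aux: _ ≟ out   = no λ ()
out ≟ in: _    = no λ ()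
out ≟ aux: _   = no λ ()
out ≟ out      = yes refl

State : Set
State = Focus → Bool

_[_≔_] : State → Focus → Bool → State
(s [ f ≔ b ]) g = if does (g ≟ f) then b else s g

effect : Basic → State → State
effect (f · set: b) s = s [ f ≔ b ]
effect (f · get)    s = s

reply : Basic → State → Bool
reply (f · set: b) s = b
reply (f · get)    s = s f

-- Positions are numbered from 1.
fetch : List Instr → ℕ → Maybe Instr
fetch []       _             = nothing
fetch (u ∷ us) zero          = nothing
fetch (u ∷ us) (suc zero)    = just u
fetch (u ∷ us) (suc (suc i)) = fetch us (suc i)

data Outcome : Set where
  terminated : State → Outcome
  deadlocked : Outcome

-- Exec X i s as o: execution of X from counter i and register contents s
-- executes exactly the basic instructions as, in this order, and ends in o.
data Exec (X : InstrSeq) : ℕ → State → List Basic → Outcome → Set where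
  beyond-end : ∀ {i s} → length X < i → Exec X i s [] deadlocked

  halt : ∀ {i s} → fetch (toList X) i ≡ just ! → Exec X i s [] (terminated s)

  jump-zero : ∀ {i s} → fetch (toList X) i ≡ just (# 0) →
              Exec X i s [] deadlocked

  jump : ∀ {i s l as o} .{{_ : NonZero l}} →
         fetch (toList X) i ≡ just (# l) →
         Exec X (i + l) s as o →
         Exec X i s as o

  exec-plain : ∀ {i s a as o} → fetch (toList X) i ≡ just (plain a) →
               Exec X (i + 1) (effect a s) as o →
               Exec X i s (a ∷ as) o

  exec-+test : ∀ {i s a as o} → fetch (toList X) i ≡ just (+test a) →
               Exec X (if reply a s then i + 1 else i + 2) (effect a s) as o →
               Exec X i s (a ∷ as) o

  exec--test : ∀ {i s a as o} → fetch (toList X) i ≡ just (-test a) →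
               Exec X (if reply a s then i + 2 else i + 1) (effect a s) as o →
               Exec X i s (a ∷ as) o

data _contains_ : Instr → Basic → Set where
  in-plain : ∀ {a} → plain a contains a
  in-+test : ∀ {a} → +test a contains a
  in--test : ∀ {a} → -test a contains a

EveryBasic : (Basic → Set) → InstrSeq → Set
EveryBasic P X = ∀ {u a} → u ∈ toList X → u contains a → P a

data BrBasic : Basic → Set where
  in-get  : ∀ {i} .{{_ : NonZero i}} → BrBasic (in: i · get)
  aux-get : ∀ {i} .{{_ : NonZero i}} → BrBasic (aux: i · get)
  aux-set : ∀ {i b} .{{_ : NonZero i}} → BrBasic (aux: i · set: b)
  out-set : ∀ {b} → BrBasic (out · set: b)

data NaBasic : Basic → Set where
  in-get  : ∀ {i} .{{_ : NonZero i}} → NaBasic (in: i · get)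
  out-set : ∀ {b} → NaBasic (out · set: b)

IS-br IS-br-na : InstrSeq → Set
IS-br    = EveryBasic BrBasic
IS-br-na = EveryBasic NaBasic

IS-br-na⊆IS-br : ∀ {X} → IS-br-na X → IS-br X
IS-br-na⊆IS-br na u∈X a∈u with na u∈X a∈u
... | in-get  = in-get
... | out-set = out-set

-- The registers in:j with j > n are left unconstrained.
record Initial {n : ℕ} (bs : Vec Bool n) (s : State) : Set where
  field
    inputs    : (j : Fin n) → s (in: (suc (toℕ j))) ≡ lookup bs j
    auxiliary : ∀ i .{{_ : NonZero i}} → s (aux: i) ≡ false
    output    : s out ≡ false

data BeyondInputs (n : ℕ) : Basic → Set where
  beyond : ∀ {j m} .{{_ : NonZero j}} → n < j → BeyondInputs n (in: j · m)

-- Exec is deterministic, so a terminating execution excludes deadlock.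
_computes_ : InstrSeq → {n : ℕ} → (Vec Bool n → Bool) → Set
_computes_ X {n} f =
  ∀ (bs : Vec Bool n) s → Initial bs s →
  ∃₂ λ as s′ → Exec X 1 s as (terminated s′)
             × All (λ a → ¬ BeyondInputs n a) as
             × s′ out ≡ f bs

OnlyJump : ℕ → InstrSeq → Set
OnlyJump k X = ∀ {l} → # l ∈ toList X → l ≡ k

{-# OPTIONS --safe #-}
-- X is a disjunctive normal form: for every v ∈ 𝔹ⁿ it has a block that sets
-- out to f v exactly when the inputs equal v. In a block, tests of in:1 … in:n
-- alternate with copies of #2. A test that agrees with v skips the #2 after
-- it and so reaches the next test; a test that disagrees enters the chain of
-- #2's, which runs past the tests and jumps over the final assignment.
module Submission where

open import Defs
open import Data.Bool.Base using (Bool; true; false; if_then_else_; not)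
import Data.Bool.Properties as Bool
open import Data.Bool.Properties using (¬-not)
open import Data.Fin.Base using (Fin; toℕ)
open import Data.Fin.Properties using (toℕ<n)
import Data.List.Base as List
open import Data.List.Base
  using (List; []; _∷_; _++_; allFin; cartesianProductWith; concatMap)
open import Data.List.Membership.Propositional using (_∈_)
open import Data.List.Membership.Propositional.Properties
  using (∈-allFin; ∈-cartesianProductWith⁺)
open import Data.List.NonEmpty.Base using (length; toList; _∷_)
open import Data.List.Properties
  using (++-assoc; length-++; length-map; length-tabulate)
open import Data.List.Relation.Unary.All as All using (All; []; _∷_)
open import Data.List.Relation.Unary.All.Properties using (++⁺)
open import Data.List.Relation.Unary.Any using (here; there)
open import Data.Maybe.Base using (just)
open import Data.Nat.Base
  using (ℕ; zero; suc; _+_; _*_; _^_; _≤_)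
open import Data.Nat.Properties
open import Data.Nat.Tactic.RingSolver using (solve-∀)
open import Data.Product.Base using (_×_; _,_; ∃₂; ∃-syntax)
open import Data.Sum.Base using (_⊎_; inj₁; inj₂)
open import Data.Vec.Base using (Vec; []; _∷_; lookup)
open import Data.Vec.Properties using (tabulate∘lookup; tabulate-cong)
open import Relation.Binary.PropositionalEquality
  using (_≡_; _≢_; refl; sym; trans; cong; cong₂; subst)
open import Relation.Nullary.Decidable.Core using (yes; no)
open import Relation.Nullary.Negation.Core using (¬_; contradiction)

-- Enumeration of the Boolean vectors.

lookup-injective : ∀ {a} {A : Set a} {n} {xs ys : Vec A n} →
                   (∀ i → lookup xs i ≡ lookup ys i) → xs ≡ ys
lookup-injective {xs = xs} {ys} eq =
  trans (sym (tabulate∘lookup xs)) (trans (tabulate-cong eq) (tabulate∘lookup ys))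

assignments : ∀ n → List (Vec Bool n)
assignments zero    = [] ∷ []
assignments (suc n) = cartesianProductWith _∷_ (true ∷ false ∷ []) (assignments n)

∈-assignments : ∀ {n} (bs : Vec Bool n) → bs ∈ assignments n
∈-assignments []       = here refl
∈-assignments (b ∷ bs) =
  ∈-cartesianProductWith⁺ _∷_ (∈-booleans b) (∈-assignments bs)
  where
  ∈-booleans : ∀ b → b ∈ true ∷ false ∷ []
  ∈-booleans true  = here refl
  ∈-booleans false = there (here refl)

length-cartesianProductWith :
  ∀ {a b c} {A : Set a} {B : Set b} {C : Set c} (g : A → B → C) xs ys →
  List.length (cartesianProductWith g xs ys) ≡ List.length xs * List.length ys
length-cartesianProductWith g []       ys = refl
length-cartesianProductWith g (x ∷ xs) ys =
  trans (length-++ (List.map (g x) ys))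
        (cong₂ _+_ (length-map (g x) ys) (length-cartesianProductWith g xs ys))

length-assignments : ∀ n → List.length (assignments n) ≡ 2 ^ n
length-assignments zero    = refl
length-assignments (suc n) =
  trans (length-cartesianProductWith _∷_ (true ∷ false ∷ []) (assignments n))
        (cong (2 *_) (length-assignments n))

-- Construction, instruction set and length of the program.

skipIf : Bool → Basic → Instr
skipIf true  = -test
skipIf false = +test

-- A single invariant on instructions, from which both the restriction on basic instructions and the
-- one on jumps are read off.
data Permitted : Instr → Set where
  literal : ∀ {b i} → Permitted (skipIf b (in: (suc i) · get))
  assign  : ∀ {b} → Permitted (plain (out · set: b))
  skip    : Permitted (# 2)
  stop    : Permitted !

permitted⇒NaBasic : ∀ {u a} → Permitted u → u contains a → NaBasic a
permitted⇒NaBasic (literal {true})  in--test = in-get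
permitted⇒NaBasic (literal {false}) in-+test = in-get
permitted⇒NaBasic assign            in-plain = out-set

-- The equation is a separate argument because `skipIf b a` is not in constructor form: it cannot be
-- unified with `# l` before `b` is known.
permitted⇒#2 : ∀ {u l} → Permitted u → u ≡ # l → l ≡ 2
permitted⇒#2 (literal {true})  ()
permitted⇒#2 (literal {false}) ()
permitted⇒#2 skip              refl = refl

module _ {n : ℕ} where

  block : List (Fin n) → Vec Bool n → Bool → List Instr
  block []       v y = plain (out · set: y) ∷ []
  block (j ∷ js) v y = skipIf (lookup v j) (in: (suc (toℕ j)) · get) ∷ # 2 ∷ block js v y

  block-permitted : ∀ js v y → All Permitted (block js v y)
  block-permitted []       v y = assign ∷ []
  block-permitted (j ∷ js) v y = literal {lookup v j} ∷ skip ∷ block-permitted js v y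

  length-block : ∀ js v y → List.length (block js v y) ≡ suc (List.length js * 2)
  length-block []       v y = refl
  length-block (j ∷ js) v y = cong (λ m → suc (suc m)) (length-block js v y)

module _ {n : ℕ} (f : Vec Bool n → Bool) where

  blockOf : Vec Bool n → List Instr
  blockOf v = block (allFin n) v (f v)

  body : List (Vec Bool n) → List Instr
  body vs = concatMap blockOf vs ++ ! ∷ []

  -- The leading assignment has no effect; it only exposes nonemptiness.
  program : InstrSeq
  program = plain (out · set: false) ∷ body (assignments n)

  body-∷ : ∀ v vs → body (v ∷ vs) ≡ blockOf v ++ body vs
  body-∷ v vs = ++-assoc (blockOf v) (concatMap blockOf vs) (! ∷ [])

  body-permitted : ∀ vs → All Permitted (body vs)
  body-permitted []       = stop ∷ []
  body-permitted (v ∷ vs) rewrite body-∷ v vs =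
    ++⁺ (block-permitted (allFin n) v (f v)) (body-permitted vs)

  program-permitted : All Permitted (toList program)
  program-permitted = assign ∷ body-permitted (assignments n)

  length-body : ∀ vs → List.length (body vs) ≡ suc (List.length vs * suc (n * 2))
  length-body []       = refl
  length-body (v ∷ vs) rewrite body-∷ v vs
    | length-++ (blockOf v) {body vs}
    | length-block (allFin n) v (f v)
    | length-tabulate {n = n} (λ j → j)
    | length-body vs
    = +-suc (suc (n * 2)) (List.length vs * suc (n * 2))

  length-program : length program ≡ 2 + 2 ^ n * suc (n * 2)
  length-program = cong suc (trans (length-body (assignments n))
    (cong (λ m → suc (m * suc (n * 2))) (length-assignments n)))

-- Execution of tests, jump chains and blocks.

in-range : ∀ {n m} (j : Fin n) → ¬ BeyondInputs n (in: (suc (toℕ j)) · m)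
in-range j (beyond n<j) = <⇒≱ n<j (toℕ<n j)

module _ (X : InstrSeq) where

  -- Says through `fetch` alone that `us` is the part of `X` from counter `i` on, so that no prefix
  -- of `X` has to be carried along. The `suc` below reflects that positions start at 1.
  record At (i : ℕ) (us : List Instr) : Set where
    constructor agreeing
    field
      fetch-at : ∀ k → fetch (toList X) (i + k) ≡ fetch us (suc k)

  branch : ∀ {b c i j s as o} → b ≡ c → Exec X (if c then i else j) s as o →
           Exec X (if b then i else j) s as o
  branch refl ex = ex

  module _ {i : ℕ} where

    fetch-head : ∀ {u us} → At i (u ∷ us) → fetch (toList X) i ≡ just u
    fetch-head at = trans (cong (fetch (toList X)) (sym (+-identityʳ i))) (At.fetch-at at 0)

    At-+1 : ∀ {u us} → At i (u ∷ us) → At (i + 1) us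
    At-+1 at = agreeing λ k →
      trans (cong (fetch (toList X)) (+-assoc i 1 k)) (At.fetch-at at (1 + k))

    At-+2 : ∀ {u v us} → At i (u ∷ v ∷ us) → At (i + 2) us
    At-+2 at = agreeing λ k →
      trans (cong (fetch (toList X)) (+-assoc i 2 k)) (At.fetch-at at (2 + k))

    exec-agree : ∀ {s a as o} b → fetch (toList X) i ≡ just (skipIf b a) →
                 reply a s ≡ b → Exec X (i + 2) (effect a s) as o → Exec X i s (a ∷ as) o
    exec-agree true  eq r ex = exec--test eq (branch r ex)
    exec-agree false eq r ex = exec-+test eq (branch r ex)

    exec-disagree : ∀ {s a as o} b → fetch (toList X) i ≡ just (skipIf b a) →
                    reply a s ≡ not b → Exec X (i + 1) (effect a s) as o → Exec X i s (a ∷ as) o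
    exec-disagree true  eq r ex = exec--test eq (branch r ex)
    exec-disagree false eq r ex = exec-+test eq (branch r ex)

  module _ {n : ℕ} (f : Vec Bool n → Bool) (bs : Vec Bool n) where

    -- What `computes` demands on input `bs`, generalised to any counter and state, so that runs can
    -- be assembled backwards from termination.
    Yields : ℕ → State → Set
    Yields i s = ∃₂ λ as s′ → Exec X i s as (terminated s′)
                            × All (λ a → ¬ BeyondInputs n a) as
                            × s′ out ≡ f bs

    Loaded : State → Set
    Loaded s = (j : Fin n) → s (in: (suc (toℕ j))) ≡ lookup bs j

    yields-set : ∀ {i s b} → fetch (toList X) i ≡ just (plain (out · set: b)) →
                 Yields (i + 1) (s [ out ≔ b ]) → Yields i s
    yields-set eq (as , s′ , ex , within , res) =
      _ , s′ , exec-plain eq ex , (λ ()) ∷ within , res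

    yields-jump : ∀ {i s} → fetch (toList X) i ≡ just (# 2) →
                  Yields (i + 2) s → Yields i s
    yields-jump eq (as , s′ , ex , within , res) = as , s′ , jump eq ex , within , res

    yields-skipIf : ∀ {i s} b (j : Fin n) → Loaded s →
                    fetch (toList X) i ≡ just (skipIf b (in: (suc (toℕ j)) · get)) →
                    (lookup bs j ≡ b → Yields (i + 2) s) →
                    (lookup bs j ≢ b → Yields (i + 1) s) →
                    Yields i s
    yields-skipIf b j loaded eq match mismatch with lookup bs j Bool.≟ b
    ... | yes bⱼ≡b = let as , s′ , ex , within , res = match bⱼ≡b in
      _ , s′ , exec-agree b eq (trans (loaded j) bⱼ≡b) ex , in-range j ∷ within , res
    ... | no bⱼ≢b = let as , s′ , ex , within , res = mismatch bⱼ≢b in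
      _ , s′ , exec-disagree b eq (trans (loaded j) (¬-not bⱼ≢b)) ex , in-range j ∷ within , res

    -- Each `# 2` leaps over one test, and the last one over the assignment, so `s` is unchanged. As
    -- the continuation accepts every counter, the end of the block need not be computed.
    yields-chain : ∀ js {v : Vec Bool n} {y us i s} → At i (# 2 ∷ block js v y ++ us) →
                   (∀ {i} → At i us → Yields i s) → Yields i s
    yields-chain []       at k = yields-jump (fetch-head at) (k (At-+2 at))
    yields-chain (j ∷ js) at k =
      yields-jump (fetch-head at) (yields-chain js (At-+2 at) k)

    -- Induction on the inputs still to be tested, with one continuation per exit of the block. Each
    -- passed test adds its equation to those handed to the first; the first failed test refutes
    -- `bs ≡ v` for the second.
    yields-block : ∀ js {v y us i s} → Loaded s → At i (block js v y ++ us) →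
                   (All (λ j → lookup bs j ≡ lookup v j) js →
                    ∀ {i} → At i us → Yields i (s [ out ≔ y ])) →
                   (bs ≢ v → ∀ {i} → At i us → Yields i s) →
                   Yields i s
    yields-block []       loaded at match mismatch =
      yields-set (fetch-head at) (match [] (At-+1 at))
    yields-block (j ∷ js) {v} loaded at match mismatch =
      yields-skipIf (lookup v j) j loaded (fetch-head at)
        (λ eq → yields-block js loaded (At-+2 at) (λ eqs → match (eq ∷ eqs)) mismatch)
        (λ neq → yields-chain js (At-+1 at)
                   (mismatch λ bs≡v → neq (cong (λ w → lookup w j) bs≡v)))

    -- Invariant between blocks: the block of `bs` is still ahead, or `out` already holds the
    -- result. A matching block establishes the second alternative, and any other block preserves
    -- whichever holds.
    yields-body : ∀ vs {i s} → Loaded s → bs ∈ vs ⊎ s out ≡ f bs →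
                  At i (body f vs) → Yields i s
    yields-body []       loaded (inj₂ res) at = [] , _ , halt (fetch-head at) , [] , res
    yields-body (v ∷ vs) {i} loaded found at =
      yields-block (allFin n) loaded (subst (At i) (body-∷ f v vs) at)
        -- `loaded` also fits the updated state, since an update of `out` computes away on input
        -- registers.
        (λ eqs → yields-body vs loaded
          (inj₂ (cong f (sym (lookup-injective λ j → All.lookup eqs (∈-allFin j))))))
        (λ bs≢v → yields-body vs loaded (remaining bs≢v found))
      where
      remaining : ∀ {P : Set} → bs ≢ v → bs ∈ v ∷ vs ⊎ P → bs ∈ vs ⊎ P
      remaining bs≢v (inj₁ (here bs≡v))   = contradiction bs≡v bs≢v
      remaining bs≢v (inj₁ (there bs∈vs)) = inj₁ bs∈vs
      remaining bs≢v (inj₂ res)           = inj₂ res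

-- Correctness and size of the whole program.

program-computes : ∀ {n} (f : Vec Bool n → Bool) → program f computes f
program-computes {n} f bs s init =
  yields-set X f bs refl
    (yields-body X f bs (assignments n) (Initial.inputs init)
      -- The body starts at counter 2, where `fetch` drops the leading assignment by computation.
      (inj₁ (∈-assignments bs)) (agreeing λ k → refl))
  where X = program f

-- The two instructions outside the blocks cost at most `2 * 2 ^ n`, which gives `(2n + 3) * 2 ^ n`
-- in total; adding `n * 2 ^ n` makes it a multiple of `n + 1`, with factor 3.
size-bound : ∀ n → 2 + 2 ^ n * suc (n * 2) ≤ 3 * (n + 1) * 2 ^ n
size-bound n = begin
  2 + 2 ^ n * suc (n * 2)                     ≤⟨ +-monoˡ-≤ _ (*-monoʳ-≤ 2 (m^n>0 2 n)) ⟩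
  2 * 2 ^ n + 2 ^ n * suc (n * 2)             ≤⟨ m≤m+n _ (n * 2 ^ n) ⟩
  2 * 2 ^ n + 2 ^ n * suc (n * 2) + n * 2 ^ n ≡⟨ identity n (2 ^ n) ⟩
  3 * (n + 1) * 2 ^ n                         ∎
  where
  open ≤-Reasoning
  identity : ∀ n p → 2 * p + p * suc (n * 2) + n * p ≡ 3 * (n + 1) * p
  identity = solve-∀

theorem1 : ∃[ c ] ((n : ℕ) (f : Vec Bool n → Bool) →
    ∃[ X ] (IS-br-na X × OnlyJump 2 X × X computes f × length X ≤ c * (n + 1) * 2 ^ n))
theorem1 = 3 , λ n f →
  program f
  , (λ u∈X → permitted⇒NaBasic (All.lookup (program-permitted f) u∈X))
  , (λ #l∈X → permitted⇒#2 (All.lookup (program-permitted f) #l∈X) refl)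
  , program-computes f
  , ≤-trans (≤-reflexive (length-program f)) (size-bound n)
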